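{- Let $H = (V,E)$ be a hypertree such that for each edge $e \in E$, with $m = |e|$, there is a choice of subset $S(\pi) \subseteq [m-1]$ for each bijection $\pi: e \to [m]$ such that the set of nonconstant colorings $\chi: e \to \mathbb{P}$ is the disjoint union $$\biguplus_{\pi} A(\pi, S(\pi))$$ over all bijections $\pi: e \to [m]$. Then $X_H$ is $F$-positive.
   Context: $\mathbb{P}=\{1,2,\ldots\}$. For a finite set $e$ with $|e|=m$, a bijection $\pi: e \to [m]$ and $S \subseteq [m-1]$, $A(\pi,S)$ is the set of maps $\chi: e \to \mathbb{P}$ with $\chi(\pi^{ -1}(1)) \le \cdots \le \chi(\pi^{ -1}(m))$ and $\chi(\pi^{ -1}(i)) < \chi(\pi^{ -1}(i+1))$ for $i \in S$. A hypergraph is a pair $H=(V,E)$ with $V$ finite and $E$ a family of subsets of $V$ with $|e|>1$. A path is a sequence $v_1, e_1, v_2, \ldots, e_m, v_{m+1}$ with $e_i \in E$, $v_i, v_{i+1} \in e_i$, edges distinct and vertices distinct except that $v_1 = v_{m+1}$ is allowed; if $v_1 = v_{m+1}$ and $m>1$ it is a cycle. A hypertree is a connected hypergraph with no cycles. A coloring of $V$ is proper if it is nonconstant on every edge; $X_H = \sum_\chi \prod_{v\in V} x_{\chi(v)}$ over proper colorings. With $n=|V|$, $F_S = \sum x_{i_1}\cdots x_{i_n}$ over $i_1 \le \cdots \le i_n$ in $\mathbb{P}$ with $i_j < i_{j+1}$ for $j \in S$; $X_H$ is $F$-positive if all coefficients of its expansion in the $F_S$, $S \subseteq [n-1]$,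 are nonnegative. -}

module Defs where

open import Data.Nat.Base using (ℕ; zero; suc; _∸_; _≤_; _<_)
open import Data.Nat.Properties using (_≟_; _≤?_; _<?_)
open import Data.Integer.Base as ℤ using (ℤ; +_; 0ℤ)
open import Data.Fin.Base using (Fin; zero; suc; inject₁; fromℕ)
open import Data.Fin.Properties using (all?)
open import Data.Fin.Subset using (Subset; inside; outside; _∈_; ∣_∣)
open import Data.Fin.Subset.Properties using (_∈?_)
open import Data.List.Base using (List; []; _∷_; [_]; length; map; filter; foldr; upTo; cartesianProductWith)
open import Data.List.Properties using (≡-dec)
open import Data.List.Relation.Unary.All as All using (All)
open import Data.List.Relation.Unary.Unique.Propositional using (Unique)
import Data.List.Membership.Propositional as List
open import Data.Vec.Base using (Vec; []; _∷_; lookup; count)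
open import Data.Product.Base using (Σ; ∃; _×_; _,_; proj₁)
open import Data.Sum.Base using (_⊎_)
open import Function.Base using (_∘_)
open import Function.Bundles using (_↔_; _⇔_; Inverse)
open import Function.Definitions using (Injective)
open import Relation.Nullary.Decidable using (Dec; map′; ¬?; _×-dec_; _→-dec_)
open import Relation.Nullary.Negation using (¬_)
open import Relation.Unary using (Pred; Decidable)
open import Relation.Binary.PropositionalEquality using (_≡_)
open import Level using (0ℓ)

-- The natural number i stands for the colour i + 1; only the order of ℙ is used.
ℙ : Set
ℙ = ℕ

-- The positions i and i + 1 in [m] of an index i ∈ [m - 1].
this next : ∀ {m} → Fin (m ∸ 1) → Fin m
this {suc m} i = inject₁ i
next {suc m} i = suc i

Ascending : ∀ {m} → Subset (m ∸ 1) → (Fin m → ℙ) → Set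
Ascending S f = ∀ i → f (this i) ≤ f (next i) × (i ∈ S → f (this i) < f (next i))

ascending? : ∀ {m} (S : Subset (m ∸ 1)) (f : Fin m → ℙ) → Dec (Ascending S f)
ascending? S f = all? λ i →
  (f (this i) ≤? f (next i)) ×-dec ((i ∈? S) →-dec (f (this i) <? f (next i)))

El : ∀ {n} → Subset n → Set
El {n} e = Σ (Fin n) (_∈ e)

NonConstant : ∀ {n} {e : Subset n} → (El e → ℙ) → Set
NonConstant χ = ¬ (∀ u v → χ u ≡ χ v)

Bijection : ∀ {n} → Subset n → Set
Bijection e = El e ↔ Fin ∣ e ∣

_≗ᵇ_ : ∀ {n} {e : Subset n} → Bijection e → Bijection e → Set
π ≗ᵇ ρ = ∀ v → Inverse.to π v ≡ Inverse.to ρ v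

A : ∀ {n} {e : Subset n} → Bijection e → Subset (∣ e ∣ ∸ 1) → (El e → ℙ) → Set
A π S χ = Ascending S (χ ∘ Inverse.from π)

record Decomposable {n} (e : Subset n) : Set where
  field
    S        : Bijection e → Subset (∣ e ∣ ∸ 1)
    -- S is a function of the underlying map of π; without function
    -- extensionality this has to be required.
    S-cong   : ∀ {π ρ} → π ≗ᵇ ρ → S π ≡ S ρ
    union    : ∀ (χ : El e → ℙ) → NonConstant χ ⇔ ∃ λ π → A π (S π) χ
    disjoint : ∀ {π ρ} (χ : El e → ℙ) → A π (S π) χ → A ρ (S ρ) χ → π ≗ᵇ ρ

record Hypergraph (n : ℕ) : Set where
  field
    edges    : List (Subset n)
    distinct : Unique edges
    size     : All (λ e → 1 < ∣ e ∣) edges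

open Hypergraph public using (edges)

-- Paths with m edges; m = 0 is the trivial path at a vertex.
record Path {n} (H : Hypergraph n) (m : ℕ) : Set where
  field
    vertex          : Fin (suc m) → Fin n
    edge            : Fin m → Subset n
    edge∈           : ∀ i → edge i List.∈ edges H
    source∈         : ∀ i → vertex (inject₁ i) ∈ edge i
    target∈         : ∀ i → vertex (suc i) ∈ edge i
    edges-distinct  : Injective _≡_ _≡_ edge
    vertex-distinct : ∀ i j → vertex i ≡ vertex j →
                      i ≡ j ⊎ (i ≡ zero × j ≡ fromℕ m) ⊎ (i ≡ fromℕ m × j ≡ zero)

  start end : Fin n
  start = vertex zero
  end   = vertex (fromℕ m)

IsCycle : ∀ {n m} {H : Hypergraph n} → Path H m → Set
IsCycle {m = m} p = Path.start p ≡ Path.end p × 1 < m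

Connected : ∀ {n} → Hypergraph n → Set
Connected H = ∀ u v → ∃ λ m → Σ (Path H m) λ p → Path.start p ≡ u × Path.end p ≡ v

Acyclic : ∀ {n} → Hypergraph n → Set
Acyclic H = ∀ m (p : Path H m) → ¬ IsCycle p

IsHypertree : ∀ {n} → Hypergraph n → Set
IsHypertree H = Connected H × Acyclic H

-- Formal power series in x₀, x₁, …: the value at α₀ ∷ … ∷ αₖ₋₁ ∷ [] is the
-- coefficient of x₀^α₀ ⋯ xₖ₋₁^αₖ₋₁.
PowerSeries : Set
PowerSeries = List ℕ → ℤ

_≈_ : PowerSeries → PowerSeries → Set
f ≈ g = ∀ α → f α ≡ g α

vectors : ∀ {X : Set} → List X → ∀ n → List (Vec X n)
vectors xs zero    = [ [] ]
vectors xs (suc n) = cartesianProductWith _∷_ xs (vectors xs n)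

-- The exponents of x₀, …, xₖ₋₁ in the product of the x_{wᵢ}.
exponents : ∀ {n} → ℕ → Vec ℙ n → List ℕ
exponents k w = map (λ i → count (i ≟_) w) (upTo k)

-- The sum of the monomials x_{w₁} ⋯ x_{wₙ} over the words w ∈ ℙⁿ satisfying P.
-- A word contributing to x₀^α₀ ⋯ xₖ₋₁^αₖ₋₁ has all its letters below k, so each
-- coefficient counts a finite set.
∑x : ∀ {n} {P : Pred (Vec ℙ n) 0ℓ} → Decidable P → PowerSeries
∑x {n} P? α = + length (filter contributes? (vectors (upTo k) n))
  where
  k = length α
  contributes? = λ w → P? w ×-dec ≡-dec _≟_ (exponents k w) α

restrict : ∀ {n} (e : Subset n) → (Fin n → ℙ) → El e → ℙ
restrict e χ = χ ∘ proj₁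

Proper : ∀ {n} → Hypergraph n → (Fin n → ℙ) → Set
Proper H χ = All (λ e → NonConstant (restrict e χ)) (edges H)

proper? : ∀ {n} (H : Hypergraph n) (χ : Fin n → ℙ) → Dec (Proper H χ)
proper? H χ = All.all? (λ e → ¬? (map′
    (λ h (u , u∈e) (v , v∈e) → h u v u∈e v∈e)
    (λ h u v u∈e v∈e → h (u , u∈e) (v , v∈e))
    (all? λ u → all? λ v → (u ∈? e) →-dec ((v ∈? e) →-dec (χ u ≟ χ v)))))
  (edges H)

X : ∀ {n} → Hypergraph n → PowerSeries
X H = ∑x (λ w → proper? H (lookup w))

F : ∀ {n} → Subset (n ∸ 1) → PowerSeries
F {n} S = ∑x {n} (λ w → ascending? S (lookup w))

-- ∑_{S ⊆ [n - 1]} c_S F_S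
F-combination : ∀ n → (Subset (n ∸ 1) → ℤ) → PowerSeries
F-combination n c α =
  foldr ℤ._+_ 0ℤ (map (λ S → c S ℤ.* F {n} S α) (vectors (inside ∷ outside ∷ []) (n ∸ 1)))

-- The F_S form a ℤ-basis of the quasisymmetric functions of degree n, so c is
-- the unique expansion of f.
F-Positive : ℕ → PowerSeries → Set
F-Positive n f = ∃ λ c → f ≈ F-combination n c × (∀ S → 0ℤ ℤ.≤ c S)

{-# OPTIONS --safe #-}

-- A proper colouring χ picks, on every edge e, the chain π with χ ∈ A(π, S(π)).
-- Since the hypertree has no cycles, there is a height on the vertices that goes
-- up by one along every weak covering relation of these chains and down by one
-- along every strict one. Order the vertices by colour, then by height, then by
-- index: the relations imposed by the chains say precisely that certain pairs of
-- vertices come in a given order. Hence the colourings with the same chains and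
-- the same vertex ordering σ are the A(σ, D), with D the descents of the height
-- (ties broken by index) along σ. Each such class contains the colouring given by
-- the positions in σ, and contributes F_D, so the coefficient of F_D counts
-- these representatives.
module Submission where

open import Defs
open import Data.Nat.Base using (ℕ)
open import Data.List.Membership.Propositional using (_∈_)
open import Data.Bool.Base using (true; false; if_then_else_)
import Data.Bool.Properties as Bool
open import Data.Fin.Base as Fin using (Fin; zero; suc; toℕ; fromℕ; fromℕ<; inject₁)
open import Data.Fin.Permutation using (permutation)
import Data.Fin.Properties as Fin
open import Data.Fin.Subset using (Subset; inside; outside; ∣_∣) renaming (_∈_ to _∈ˢ_; _∉_ to _∉ˢ_; ⊤ to full)
open import Data.Fin.Subset.Properties as Subset using (_∈?_)
open import Data.Integer.Base as ℤ using (ℤ; 0ℤ; 1ℤ; -1ℤ; +_)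
import Data.Integer.Properties as ℤ
open import Data.Integer.Tactic.RingSolver using (solve-∀)
open import Data.List.Base as List using (List; []; _∷_; length; filter; map; foldr; upTo; cartesianProduct)
open import Data.List.Membership.Propositional.Properties
import Data.List.Properties as List
open import Data.List.Relation.Unary.All as All using (All; []; _∷_)
open import Data.List.Relation.Unary.AllPairs using ([]; _∷_)
open import Data.List.Relation.Unary.Any as Any using (here; there)
open import Data.List.Relation.Unary.Any.Properties using (lookup-index)
open import Data.List.Relation.Unary.Unique.Propositional using (Unique)
import Data.List.Relation.Unary.Unique.Propositional.Properties as Unique
open import Data.Nat.Base as ℕ using (zero; suc; _+_; _*_; _∸_; s≤s; z≤n)
open import Data.Nat.ListAction using (sum)
import Data.Nat.Properties as ℕ
open import Data.Product.Base using (Σ; ∃; _×_; _,_; proj₁; proj₂)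
open import Data.Sum.Base using (_⊎_; inj₁; inj₂; [_,_]′)
open import Data.Unit.Base using (⊤)
open import Data.Vec.Base using (Vec; []; _∷_; here; there; tabulate; lookup; count)
open import Data.Vec.Properties using (≡-dec; ∷-injective; []=⇒lookup; lookup⇒[]=; lookup∘tabulate; tabulate∘lookup; tabulate-cong)
open import Data.Vec.Properties.WithK using ([]=-irrelevant)
open import Function.Base using (_∘_)
open import Function.Bundles using (Inverse; Equivalence)
open import Level using (0ℓ)
open import Relation.Binary using (Rel; DecidableEquality; Transitive; Trichotomous; IsStrictTotalOrder; tri<; tri≈; tri>)
open import Relation.Binary.PropositionalEquality
open import Relation.Binary.Structures.Biased using (isStrictTotalOrderᶜ)
open import Relation.Nullary using (¬_; Dec; yes; no; does; contradiction; _×-dec_)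
open import Relation.Nullary.Decidable using (dec-true)
open import Relation.Unary using (Pred; Decidable)
open import Algebra.Properties.AbelianGroup ℤ.+-0-abelianGroup using (∙-cancelʳ)
open import Algebra.Properties.CommutativeMonoid.Sum ℕ.+-0-commutativeMonoid using (sum-permute; sum-cong-≗) renaming (sum to ∑)

-- Lexicographic orders, ranks and descents

module _ {V K : Set} where

  data Lex (_<_ : Rel K 0ℓ) (f : V → K) (_≺_ : Rel V 0ℓ) (u v : V) : Set where
    major : f u < f v → Lex _<_ f _≺_ u v
    minor : f u ≡ f v → u ≺ v → Lex _<_ f _≺_ u v

  module _ {_<_ : Rel K 0ℓ} {_≺_ : Rel V 0ℓ} (f : V → K)
    (<-sto : IsStrictTotalOrder _≡_ _<_) (≺-sto : IsStrictTotalOrder _≡_ _≺_) where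
    private
      module K = IsStrictTotalOrder <-sto
      module V = IsStrictTotalOrder ≺-sto

    Lex-trans : Transitive (Lex _<_ f _≺_)
    Lex-trans         (major p)    (major q)     = major (K.trans p q)
    Lex-trans {u}     (major p)    (minor eq _)  = major (subst (f u <_) eq p)
    Lex-trans {k = x} (minor eq _) (major q)     = major (subst (_< f x) (sym eq) q)
    Lex-trans         (minor eq p) (minor eq′ q) = minor (trans eq eq′) (V.trans p q)

    Lex-compare : Trichotomous _≡_ (Lex _<_ f _≺_)
    Lex-compare u v with K.compare (f u) (f v)
    ... | tri< p ¬eq ¬q = tri< (major p) (¬eq ∘ cong f) λ where
            (major q)    → ¬q q
            (minor eq _) → ¬eq (sym eq)
    ... | tri> ¬p ¬eq q = tri> (λ where (major p)    → ¬p p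
                                        (minor eq _) → ¬eq eq) (¬eq ∘ cong f) (major q)
    ... | tri≈ ¬p eq ¬q with V.compare u v
    ...   | tri< p ¬≡ ¬≻ = tri< (minor eq p) ¬≡ λ where
              (major q)   → ¬q q
              (minor _ q) → ¬≻ q
    ...   | tri≈ ¬≺ u≡v ¬≻ = tri≈ (λ where (major p)   → ¬p p
                                           (minor _ p) → ¬≺ p) u≡v λ where
              (major q)   → ¬q q
              (minor _ q) → ¬≻ q
    ...   | tri> ¬≺ ¬≡ q = tri> (λ where (major p)   → ¬p p
                                         (minor _ p) → ¬≺ p) ¬≡ (minor (sym eq) q)

    Lex-isStrictTotalOrder : IsStrictTotalOrder _≡_ (Lex _<_ f _≺_)
    Lex-isStrictTotalOrder = isStrictTotalOrderᶜ record
      { isEquivalence = isEquivalence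
      ; trans         = Lex-trans
      ; compare       = Lex-compare
      }

module _ {n : ℕ} {P : Fin n → Set} (P? : ∀ i → Dec (P i)) where

  subsetOf : Subset n
  subsetOf = tabulate (does ∘ P?)

  ∈-subsetOf⁺ : ∀ {i} → P i → i ∈ˢ subsetOf
  ∈-subsetOf⁺ {i} p = lookup⇒[]= i _ (trans (lookup∘tabulate _ i) (dec-true (P? i) p))

  ∈-subsetOf⁻ : ∀ {i} → i ∈ˢ subsetOf → P i
  ∈-subsetOf⁻ {i} i∈ with P? i | trans (sym (lookup∘tabulate (does ∘ P?) i)) ([]=⇒lookup i∈)
  ... | yes p | _ = p

-- If `j` were missed, punching it out of the values would inject `Fin (suc n)` into `Fin n`.
injective⇒surjective : ∀ {n} (f : Fin n → Fin n) → (∀ {i j} → f i ≡ f j → i ≡ j) →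
  ∀ j → ∃ λ i → f i ≡ j
injective⇒surjective {suc n} f inj j with Fin.any? (λ i → f i Fin.≟ j)
... | yes hit = hit
... | no miss = contradiction
  (Fin.injective⇒≤ {f = λ i → Fin.punchOut (j≢f i)}
    (λ eq → inj (Fin.punchOut-injective (j≢f _) (j≢f _) eq)))
  ℕ.1+n≰n
  where
  j≢f : ∀ i → j ≢ f i
  j≢f i eq = miss (i , sym eq)

adjacent⇒monotone : ∀ {m} {X : Set} (_<_ : Rel X 0ℓ) → Transitive _<_ → (f : Fin m → X) →
  (∀ i → f (this {m} i) < f (next {m} i)) → ∀ i j → i Fin.< j → f i < f j
adjacent⇒monotone {suc (suc m)} _<_ tr f adj zero (suc zero) _ = adj zero
adjacent⇒monotone {suc (suc m)} _<_ tr f adj zero (suc (suc j)) _ =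
  tr (adj zero) (adjacent⇒monotone _<_ tr (f ∘ suc) (λ i → adj (suc i)) zero (suc j) (s≤s z≤n))
adjacent⇒monotone {suc (suc m)} _<_ tr f adj (suc i) (suc j) (s≤s i<j) =
  adjacent⇒monotone _<_ tr (f ∘ suc) (λ i → adj (suc i)) i j i<j

this<next : ∀ {m} (i : Fin (m ∸ 1)) → this {m} i Fin.< next {m} i
this<next {suc m} i = s≤s (ℕ.≤-reflexive (Fin.toℕ-inject₁ i))

module Rank {n : ℕ} {_≺_ : Rel (Fin n) 0ℓ} (isSTO : IsStrictTotalOrder _≡_ _≺_) where
  open IsStrictTotalOrder isSTO using (compare; _<?_; irrefl) renaming (trans to ≺-trans)

  below : Fin n → Subset n
  below v = subsetOf (_<? v)

  v∉below : ∀ {v} → v ∉ˢ below v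
  v∉below {v} v∈ = irrefl refl (∈-subsetOf⁻ (_<? v) v∈)

  abstract
    rank : Fin n → Fin n
    -- The rank counts the elements below `v`. Since `v` is not among them, the count is less than
    -- `n`.
    rank v = fromℕ< (ℕ.<-≤-trans
      (Subset.p⊂q⇒∣p∣<∣q∣ {q = full} (Subset.⊆⊤ , v , Subset.∈⊤ , v∉below)) (Subset.∣p∣≤n full))

    toℕ-rank : ∀ v → toℕ (rank v) ≡ ∣ below v ∣
    toℕ-rank v = Fin.toℕ-fromℕ< _

  rank-mono : ∀ {u v} → u ≺ v → rank u Fin.< rank v
  rank-mono {u} {v} u≺v = subst₂ ℕ._<_ (sym (toℕ-rank u)) (sym (toℕ-rank v))
    (Subset.p⊂q⇒∣p∣<∣q∣
      ((λ x∈ → ∈-subsetOf⁺ (_<? v) (≺-trans (∈-subsetOf⁻ (_<? u) x∈) u≺v)) , u , ∈-subsetOf⁺ (_<? v) u≺v , v∉below))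

  rank-reflects : ∀ {u v} → rank u Fin.< rank v → u ≺ v
  rank-reflects {u} {v} r with compare u v
  ... | tri< p _ _    = p
  ... | tri≈ _ refl _ = contradiction r (ℕ.<-irrefl refl)
  ... | tri> _ _ q    = contradiction r (ℕ.<-asym (rank-mono q))

  rank-injective : ∀ {u v} → rank u ≡ rank v → u ≡ v
  rank-injective {u} {v} eq with compare u v
  ... | tri< p _ _ = contradiction (cong toℕ eq) (ℕ.<⇒≢ (rank-mono p))
  ... | tri≈ _ p _ = p
  ... | tri> _ _ p = contradiction (cong toℕ (sym eq)) (ℕ.<⇒≢ (rank-mono p))

  abstract
    unrank : Fin n → Fin n
    unrank i = proj₁ (injective⇒surjective rank rank-injective i)

    rank-unrank : ∀ i → rank (unrank i) ≡ i
    rank-unrank i = proj₂ (injective⇒surjective rank rank-injective i)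

  unrank-rank : ∀ v → unrank (rank v) ≡ v
  unrank-rank v = rank-injective (rank-unrank (rank v))

  unrank-mono : ∀ {i j} → i Fin.< j → unrank i ≺ unrank j
  unrank-mono i<j = rank-reflects (subst₂ Fin._<_ (sym (rank-unrank _)) (sym (rank-unrank _)) i<j)

module _ {n : ℕ} {_≺_ _≺′_ : Rel (Fin n) 0ℓ}
  (O : IsStrictTotalOrder _≡_ _≺_) (O′ : IsStrictTotalOrder _≡_ _≺′_)
  (≺⇒≺′ : ∀ {u v} → u ≺ v → u ≺′ v) where
  private
    module O  = IsStrictTotalOrder O
    module O′ = IsStrictTotalOrder O′

  -- By trichotomy, an inclusion between strict total orders is an equality. One inclusion is thus
  -- enough for two orders to have the same ranks.
  ≺′⇒≺ : ∀ {u v} → u ≺′ v → u ≺ v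
  ≺′⇒≺ {u} {v} u≺′v with O.compare u v
  ... | tri< p _ _    = p
  ... | tri≈ _ refl _ = contradiction u≺′v (O′.irrefl refl)
  ... | tri> _ _ q    = contradiction u≺′v (O′.asym (≺⇒≺′ q))

  rank-cong : ∀ v → Rank.rank O v ≡ Rank.rank O′ v
  rank-cong v = Fin.toℕ-injective (begin
    toℕ (Rank.rank O v)   ≡⟨ Rank.toℕ-rank O v ⟩
    ∣ Rank.below O v ∣    ≡⟨ cong ∣_∣ (Subset.⊆-antisym
      (λ x∈ → ∈-subsetOf⁺ (O′._<? v) (≺⇒≺′ (∈-subsetOf⁻ (O._<? v) x∈)))
      (λ x∈ → ∈-subsetOf⁺ (O._<? v) (≺′⇒≺ (∈-subsetOf⁻ (O′._<? v) x∈)))) ⟩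
    ∣ Rank.below O′ v ∣   ≡⟨ sym (Rank.toℕ-rank O′ v) ⟩
    toℕ (Rank.rank O′ v)  ∎)
    where open ≡-Reasoning

  unrank-cong : ∀ i → Rank.unrank O i ≡ Rank.unrank O′ i
  unrank-cong i = Rank.rank-injective O′ (begin
    Rank.rank O′ (Rank.unrank O i)   ≡⟨ sym (rank-cong _) ⟩
    Rank.rank O (Rank.unrank O i)    ≡⟨ Rank.rank-unrank O i ⟩
    i                                ≡⟨ sym (Rank.rank-unrank O′ i) ⟩
    Rank.rank O′ (Rank.unrank O′ i)  ∎)
    where open ≡-Reasoning

-- The vertex order by colour, height and index

module _ {n : ℕ} where

  _⊏[_]_ : Fin n → (Fin n → ℤ) → Fin n → Set
  u ⊏[ h ] v = Lex ℤ._<_ h Fin._<_ u v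

  ⊏-isStrictTotalOrder : ∀ h → IsStrictTotalOrder _≡_ _⊏[ h ]_
  ⊏-isStrictTotalOrder h = Lex-isStrictTotalOrder h ℤ.<-isStrictTotalOrder Fin.<-isStrictTotalOrder

  _≺[_,_]_ : Fin n → (Fin n → ℙ) → (Fin n → ℤ) → Fin n → Set
  u ≺[ χ , h ] v = Lex ℕ._<_ χ _⊏[ h ]_ u v

  ≺-isStrictTotalOrder : ∀ χ h → IsStrictTotalOrder _≡_ _≺[ χ , h ]_
  ≺-isStrictTotalOrder χ h = Lex-isStrictTotalOrder χ ℕ.<-isStrictTotalOrder (⊏-isStrictTotalOrder h)

  ⊏-cong : ∀ {h h′} → h ≗ h′ → ∀ {u v} → u ⊏[ h ] v → u ⊏[ h′ ] v
  ⊏-cong h≗ (major p)    = major (subst₂ ℤ._<_ (h≗ _) (h≗ _) p)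
  ⊏-cong h≗ (minor eq p) = minor (trans (sym (h≗ _)) (trans eq (h≗ _))) p

  ≺-cong : ∀ {χ χ′ h h′} → χ ≗ χ′ → h ≗ h′ → ∀ {u v} → u ≺[ χ , h ] v → u ≺[ χ′ , h′ ] v
  ≺-cong χ≗ h≗ (major p)    = major (subst₂ ℕ._<_ (χ≗ _) (χ≗ _) p)
  ≺-cong χ≗ h≗ (minor eq p) = minor (trans (sym (χ≗ _)) (trans eq (χ≗ _))) (⊏-cong h≗ p)

  -- If `⊏` already orders the pair, a tie in colour is harmless and `≺` amounts to a weak
  -- inequality of colours; if `⊏` orders it backwards, `≺` amounts to a strict one. This lemma and
  -- the next two turn weak and strict covers of a chain into statements about `≺`, and back.
  weak⇒≺ : ∀ {χ h u v} → χ u ℕ.≤ χ v → u ⊏[ h ] v → u ≺[ χ , h ] v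
  weak⇒≺ χ≤ h< = [ major , (λ eq → minor eq h<) ]′ (ℕ.m≤n⇒m<n∨m≡n χ≤)

  ≺⇒weak : ∀ {χ h u v} → u ≺[ χ , h ] v → χ u ℕ.≤ χ v
  ≺⇒weak (major p)    = ℕ.<⇒≤ p
  ≺⇒weak (minor eq _) = ℕ.≤-reflexive eq

  ≺⇒strict : ∀ {χ h u v} → u ≺[ χ , h ] v → v ⊏[ h ] u → χ u ℕ.< χ v
  ≺⇒strict         (major p)   _ = p
  ≺⇒strict {h = h} (minor _ p) q =
    contradiction p (IsStrictTotalOrder.asym (⊏-isStrictTotalOrder h) q)

  module Standard (χ : Fin n → ℙ) (h : Fin n → ℤ) where
    open Rank (≺-isStrictTotalOrder χ h) public
    open IsStrictTotalOrder (⊏-isStrictTotalOrder h) using (compare) renaming (_<?_ to _⊏?_)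

    descent? : (i : Fin (n ∸ 1)) → Dec (unrank (next {n} i) ⊏[ h ] unrank (this {n} i))
    descent? i = unrank (next {n} i) ⊏? unrank (this {n} i)

    Des : Subset (n ∸ 1)
    Des = subsetOf descent?

    -- `unrank` lists the vertices in increasing `≺`. Neighbours of equal colour follow `⊏`, so at a
    -- descent of `⊏` the colour has to rise.
    ascending : Ascending {n} Des (χ ∘ unrank)
    ascending i = ≺⇒weak step , λ i∈ → ≺⇒strict step (∈-subsetOf⁻ descent? i∈)
      where
      step : unrank (this {n} i) ≺[ χ , h ] unrank (next {n} i)
      step = unrank-mono (this<next {n} i)

    module _ {f : Fin n → ℙ} (asc : Ascending {n} Des f) where

      private
        f≡ : ∀ j → f j ≡ f (rank (unrank j))
        f≡ j = sym (cong f (rank-unrank j))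

      -- Where `⊏` goes up, the weak inequality of `f` suffices; where it goes down, the position is
      -- in `Des` and `f` rises strictly. Neighbours are never equal, as their ranks differ.
      ascending⇒adjacent : ∀ i → unrank (this {n} i) ≺[ f ∘ rank , h ] unrank (next {n} i)
      ascending⇒adjacent i with compare (unrank (this {n} i)) (unrank (next {n} i))
      ... | tri< p _ _  = weak⇒≺ (subst₂ ℕ._≤_ (f≡ (this i)) (f≡ (next i)) (proj₁ (asc i))) p
      ... | tri≈ _ eq _ = contradiction
        (cong toℕ (trans (sym (rank-unrank (this i))) (trans (cong rank eq) (rank-unrank (next i)))))
        (ℕ.<⇒≢ (this<next {n} i))
      ... | tri> _ _ q  =
        major (subst₂ ℕ._<_ (f≡ (this i)) (f≡ (next i)) (proj₂ (asc i) (∈-subsetOf⁺ descent? q)))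

      -- The adjacent comparisons are chained along `unrank`. This is the converse of `ascending`:
      -- for a fixed height, spreading any ascending `f` along the vertex ordering of `χ` reproduces
      -- that ordering.
      ascending⇒refines : ∀ {u v} → u ≺[ χ , h ] v → u ≺[ f ∘ rank , h ] v
      ascending⇒refines {u} {v} u≺v = subst₂ _≺[ f ∘ rank , h ]_ (unrank-rank u) (unrank-rank v)
        (adjacent⇒monotone _≺[ f ∘ rank , h ]_ (IsStrictTotalOrder.trans (≺-isStrictTotalOrder (f ∘ rank) h))
          unrank ascending⇒adjacent (rank u) (rank v) (rank-mono u≺v))

  module _ {χ χ′ : Fin n → ℙ} {h h′ : Fin n → ℤ} (h≗h′ : h ≗ h′)
    (refines : ∀ {u v} → u ≺[ χ , h ] v → u ≺[ χ′ , h′ ] v) where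
    private
      module S  = Standard χ h
      module S′ = Standard χ′ h′

      unrank≗ : S.unrank ≗ S′.unrank
      unrank≗ = unrank-cong (≺-isStrictTotalOrder χ h) (≺-isStrictTotalOrder χ′ h′) refines

    Des-cong : S.Des ≡ S′.Des
    Des-cong = Subset.⊆-antisym
      (λ {i} i∈ → ∈-subsetOf⁺ S′.descent? (subst₂ _⊏[ h′ ]_ (unrank≗ (next i)) (unrank≗ (this i))
        (⊏-cong h≗h′ (∈-subsetOf⁻ S.descent? i∈))))
      (λ {i} i∈ → ∈-subsetOf⁺ S.descent? (subst₂ _⊏[ h ]_ (sym (unrank≗ (next i))) (sym (unrank≗ (this i)))
        (⊏-cong (λ v → sym (h≗h′ v)) (∈-subsetOf⁻ S′.descent? i∈))))

-- Walks and potentials in hypertrees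

lookup-injective : ∀ {X : Set} {xs : List X} → Unique xs → ∀ {i j} →
  List.lookup xs i ≡ List.lookup xs j → i ≡ j
lookup-injective (_ ∷ _)     {zero}  {zero}  _  = refl
lookup-injective (x∉ ∷ _)    {zero}  {suc j} eq = contradiction eq (All.lookup x∉ (∈-lookup j))
lookup-injective (x∉ ∷ _)    {suc i} {zero}  eq = contradiction (sym eq) (All.lookup x∉ (∈-lookup i))
lookup-injective (_ ∷ xs!)   {suc i} {suc j} eq = cong suc (lookup-injective xs! eq)

-- The root vertex; it takes a vertex as argument because n may be 0.
base : ∀ {n} → Fin n → Fin n
base {suc n} _ = zero

base-const : ∀ {n} (u v : Fin n) → base u ≡ base v
base-const {suc n} _ _ = refl

module Walks {n : ℕ} (H : Hypergraph n) where

  -- Edges are positions in the list, which makes their equality decidable; the list has no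
  -- repetitions, so distinct positions are distinct edges.
  Edge : Set
  Edge = Fin (length (edges H))

  verts : Edge → Subset n
  verts = List.lookup (edges H)

  -- Vertices and edges may repeat, and a step may stay where it is, so that walks can be
  -- concatenated freely.
  data Walk : Fin n → Fin n → Set where
    nil  : ∀ {u} → Walk u u
    cons : ∀ {u v x} (e : Edge) → u ∈ˢ verts e → v ∈ˢ verts e → Walk v x → Walk u x

  _++ʷ_ : ∀ {u v x} → Walk u v → Walk v x → Walk u x
  nil          ++ʷ W′ = W′
  cons e p q W ++ʷ W′ = cons e p q (W ++ʷ W′)

  _∉ᵛ_ : ∀ {u x} → Fin n → Walk u x → Set
  _∉ᵛ_ {u} a nil            = a ≢ u
  _∉ᵛ_ {u} a (cons _ _ _ W) = a ≢ u × a ∉ᵛ W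

  _∉ᵉ_ : ∀ {u x} → Edge → Walk u x → Set
  e ∉ᵉ nil           = ⊤
  e ∉ᵉ cons e′ _ _ W = e ≢ e′ × e ∉ᵉ W

  Simple : ∀ {u x} → Walk u x → Set
  Simple nil                = ⊤
  Simple (cons {u} e _ _ W) = u ∉ᵛ W × e ∉ᵉ W × Simple W

  len : ∀ {u x} → Walk u x → ℕ
  len nil            = 0
  len (cons _ _ _ W) = suc (len W)

  vertexAt : ∀ {u x} (W : Walk u x) → Fin (suc (len W)) → Fin n
  vertexAt {u} W              zero    = u
  vertexAt     (cons _ _ _ W) (suc i) = vertexAt W i

  edgeAt : ∀ {u x} (W : Walk u x) → Fin (len W) → Edge
  edgeAt (cons e _ _ W) zero    = e
  edgeAt (cons e _ _ W) (suc i) = edgeAt W i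

  source∈ : ∀ {u x} (W : Walk u x) i → vertexAt W (inject₁ i) ∈ˢ verts (edgeAt W i)
  source∈ (cons e p q W) zero    = p
  source∈ (cons e p q W) (suc i) = source∈ W i

  target∈ : ∀ {u x} (W : Walk u x) i → vertexAt W (suc i) ∈ˢ verts (edgeAt W i)
  target∈ (cons e p q W) zero    = q
  target∈ (cons e p q W) (suc i) = target∈ W i

  vertexAt-end : ∀ {u x} (W : Walk u x) → vertexAt W (fromℕ (len W)) ≡ x
  vertexAt-end nil            = refl
  vertexAt-end (cons _ _ _ W) = vertexAt-end W

  ∉ᵛ⇒≢ : ∀ {a u x} (W : Walk u x) → a ∉ᵛ W → ∀ i → a ≢ vertexAt W i
  ∉ᵛ⇒≢ nil            a∉       zero    = a∉
  ∉ᵛ⇒≢ (cons _ _ _ W) (a≢ , _) zero    = a≢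
  ∉ᵛ⇒≢ (cons _ _ _ W) (_ , a∉) (suc i) = ∉ᵛ⇒≢ W a∉ i

  ∉ᵉ⇒≢ : ∀ {e u x} (W : Walk u x) → e ∉ᵉ W → ∀ i → e ≢ edgeAt W i
  ∉ᵉ⇒≢ (cons _ _ _ W) (e≢ , _) zero    = e≢
  ∉ᵉ⇒≢ (cons _ _ _ W) (_ , e∉) (suc i) = ∉ᵉ⇒≢ W e∉ i

  vertexAt-injective : ∀ {u x} (W : Walk u x) → Simple W → ∀ {i j} → vertexAt W i ≡ vertexAt W j → i ≡ j
  vertexAt-injective W              _            {zero}  {zero}  _  = refl
  vertexAt-injective (cons _ _ _ W) (u∉ , _ , _) {zero}  {suc j} eq = contradiction eq (∉ᵛ⇒≢ W u∉ j)
  vertexAt-injective (cons _ _ _ W) (u∉ , _ , _) {suc i} {zero}  eq = contradiction (sym eq) (∉ᵛ⇒≢ W u∉ i)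
  vertexAt-injective (cons _ _ _ W) (_ , _ , s)  {suc i} {suc j} eq = cong suc (vertexAt-injective W s eq)

  edgeAt-injective : ∀ {u x} (W : Walk u x) → Simple W → ∀ {i j} → edgeAt W i ≡ edgeAt W j → i ≡ j
  edgeAt-injective (cons _ _ _ W) _            {zero}  {zero}  _  = refl
  edgeAt-injective (cons _ _ _ W) (_ , e∉ , _) {zero}  {suc j} eq = contradiction eq (∉ᵉ⇒≢ W e∉ j)
  edgeAt-injective (cons _ _ _ W) (_ , e∉ , _) {suc i} {zero}  eq = contradiction (sym eq) (∉ᵉ⇒≢ W e∉ i)
  edgeAt-injective (cons _ _ _ W) (_ , _ , s)  {suc i} {suc j} eq = cong suc (edgeAt-injective W s eq)

  data Prefix : ∀ {u x a} → Walk u a → Walk u x → Set where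
    nil  : ∀ {u x} {W : Walk u x} → Prefix nil W
    cons : ∀ {u v x a e p q} {W′ : Walk v a} {W : Walk v x} → Prefix W′ W →
           Prefix (cons {u} e p q W′) (cons e p q W)

  Prefix-∉ᵛ : ∀ {b u x a} {W′ : Walk u a} {W : Walk u x} → Prefix W′ W → b ∉ᵛ W → b ∉ᵛ W′
  Prefix-∉ᵛ {W = nil}          nil      b∉        = b∉
  Prefix-∉ᵛ {W = cons _ _ _ _} nil      (b≢ , _)  = b≢
  Prefix-∉ᵛ                    (cons P) (b≢ , b∉) = b≢ , Prefix-∉ᵛ P b∉

  Prefix-∉ᵉ : ∀ {e u x a} {W′ : Walk u a} {W : Walk u x} → Prefix W′ W → e ∉ᵉ W → e ∉ᵉ W′
  Prefix-∉ᵉ nil      _         = _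
  Prefix-∉ᵉ (cons P) (e≢ , e∉) = e≢ , Prefix-∉ᵉ P e∉

  Prefix-Simple : ∀ {u x a} {W′ : Walk u a} {W : Walk u x} → Prefix W′ W → Simple W → Simple W′
  Prefix-Simple nil      _              = _
  Prefix-Simple (cons P) (u∉ , e∉ , s) = Prefix-∉ᵛ P u∉ , Prefix-∉ᵉ P e∉ , Prefix-Simple P s

  Prefix-end : ∀ {b u x a} {W′ : Walk u a} {W : Walk u x} → Prefix W′ W → b ∉ᵛ W → b ≢ a
  Prefix-end {W = nil}          nil      b∉       = b∉
  Prefix-end {W = cons _ _ _ _} nil      (b≢ , _) = b≢
  Prefix-end                    (cons P) (_ , b∉) = Prefix-end P b∉

  prefixTo : ∀ {u x} a (W : Walk u x) → a ∉ᵛ W ⊎ Σ (Walk u a) λ W′ → Prefix W′ W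
  prefixTo {u} a W with a Fin.≟ u
  prefixTo     a W              | yes refl = inj₂ (nil , nil)
  prefixTo     a nil            | no a≢u   = inj₁ a≢u
  prefixTo     a (cons e p q W) | no a≢u   with prefixTo a W
  ... | inj₁ a∉       = inj₁ (a≢u , a∉)
  ... | inj₂ (W′ , P) = inj₂ (cons e p q W′ , cons P)

  -- The walk is cut at the first use of `e`; `a` is the vertex at which that step starts.
  prefixBefore : ∀ {u x} e (W : Walk u x) →
    e ∉ᵉ W ⊎ ∃ λ a → a ∈ˢ verts e × Σ (Walk u a) λ W′ → Prefix W′ W × e ∉ᵉ W′
  prefixBefore e nil = inj₁ _
  prefixBefore e (cons e′ p q W) with e Fin.≟ e′
  ... | yes refl = inj₂ (_ , p , nil , nil , _)
  ... | no e≢ with prefixBefore e W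
  ...   | inj₁ e∉                    = inj₁ (e≢ , e∉)
  ...   | inj₂ (a , a∈ , W′ , P , e∉) = inj₂ (a , a∈ , cons e′ p q W′ , cons P , e≢ , e∉)

  fromPath : ∀ m (v : Fin (suc m) → Fin n) (e : Fin m → Edge) →
    (∀ i → v (inject₁ i) ∈ˢ verts (e i)) → (∀ i → v (suc i) ∈ˢ verts (e i)) →
    Walk (v zero) (v (fromℕ m))
  fromPath zero    v e s t = nil
  fromPath (suc m) v e s t =
    cons (e zero) (s zero) (t zero) (fromPath m (v ∘ suc) (e ∘ suc) (s ∘ suc) (t ∘ suc))

  connected⇒walk : Connected H → ∀ u v → Walk u v
  connected⇒walk con u v with con u v
  ... | m , p , refl , refl = fromPath m vertex (Any.index ∘ edge∈)
    (λ i → subst (vertex (inject₁ i) ∈ˢ_) (lookup-index (edge∈ i)) (Path.source∈ p i))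
    (λ i → subst (vertex (suc i) ∈ˢ_) (lookup-index (edge∈ i)) (Path.target∈ p i))
    where open Path p using (vertex; edge∈)

  -- Totals of edge potentials along walks

  module _ (g : Edge → Fin n → ℤ) where

    step : Edge → Fin n → Fin n → ℤ
    step e u v = g e v ℤ.- g e u

    -- Every edge carries its own potential, so in general this sum telescopes only over consecutive
    -- steps along one edge.
    total : ∀ {u x} → Walk u x → ℤ
    total nil                    = 0ℤ
    total (cons {u} {v} e _ _ W) = step e u v ℤ.+ total W

    total-++ : ∀ {u v x} (W : Walk u v) (W′ : Walk v x) → total (W ++ʷ W′) ≡ total W ℤ.+ total W′
    total-++ nil                    W′ = sym (ℤ.+-identityˡ _)
    total-++ (cons {u} {v} e _ _ W) W′ =
      trans (cong (λ t → step e u v ℤ.+ t) (total-++ W W′)) (sym (ℤ.+-assoc (step e u v) (total W) (total W′)))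

  module Cycles (acyclic : Acyclic H) where

    -- Otherwise e closes W up to a cycle.
    chord : ∀ {u x} e (W : Walk u x) → Simple W → e ∉ᵉ W → u ∈ˢ verts e → x ∈ˢ verts e → u ≡ x
    chord e nil              _ _  _  _  = refl
    chord {u} {x} e W@(cons _ _ _ W₁) s e∉ u∈ x∈ =
      contradiction (sym (vertexAt-end W) , s≤s (s≤s z≤n)) (acyclic (suc (len W)) path)
      where
      -- The cycle starts at `x`, crosses `e` to `u` and follows `W` back to `x`. It has at least
      -- two edges because `W` is not empty.
      vertex : Fin (suc (suc (len W))) → Fin n
      vertex zero    = x
      vertex (suc i) = vertexAt W i

      edge : Fin (suc (len W)) → Edge
      edge zero    = e
      edge (suc i) = edgeAt W i

      edge-injective : ∀ {i j} → edge i ≡ edge j → i ≡ j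
      edge-injective {zero}  {zero}  _  = refl
      edge-injective {zero}  {suc j} eq = contradiction eq (∉ᵉ⇒≢ W e∉ j)
      edge-injective {suc i} {zero}  eq = contradiction (sym eq) (∉ᵉ⇒≢ W e∉ i)
      edge-injective {suc i} {suc j} eq = cong suc (edgeAt-injective W s eq)

      -- The simple walk `W` meets `x` only at its end, so the only repetition is the first vertex
      -- of the cycle at its last position.
      isEnd : ∀ i → x ≡ vertexAt W i → suc i ≡ fromℕ (suc (len W))
      isEnd i eq = cong suc (vertexAt-injective W s (trans (sym eq) (sym (vertexAt-end W))))

      path : Path H (suc (len W))
      path = record
        { vertex          = vertex
        ; edge            = verts ∘ edge
        ; edge∈           = λ i → ∈-lookup (edge i)
        ; source∈         = λ { zero → x∈ ; (suc i) → source∈ W i }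
        ; target∈         = λ { zero → u∈ ; (suc i) → target∈ W i }
        ; edges-distinct  = edge-injective ∘ lookup-injective (Hypergraph.distinct H)
        ; vertex-distinct = λ where
            zero    zero    _  → inj₁ refl
            zero    (suc j) eq → inj₂ (inj₁ (refl , isEnd j eq))
            (suc i) zero    eq → inj₂ (inj₂ (isEnd i (sym eq) , refl))
            (suc i) (suc j) eq → inj₁ (cong suc (vertexAt-injective W s eq))
        }

    module _ (g : Edge → Fin n → ℤ) where

      Simplified : ∀ {u x} → Walk u x → Set
      Simplified {u} {x} W = Σ (Walk u x) λ W′ → Simple W′ × total g W′ ≡ total g W

      cons-fresh : ∀ {u v x} e (p : u ∈ˢ verts e) (q : v ∈ˢ verts e) (W : Walk v x) →
        Simple W → e ∉ᵉ W → Simplified (cons e p q W)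
      cons-fresh {u} {v} e p q W s e∉ with prefixTo u W
      ... | inj₁ u∉       = cons e p q W , (u∉ , e∉ , s) , refl
      ... | inj₂ (W′ , P) with chord e W′ (Prefix-Simple P s) (Prefix-∉ᵉ P e∉) q p
      ...   | refl = W , s , sym (trans (cong (ℤ._+ total g W) (ℤ.+-inverseʳ (g e u))) (ℤ.+-identityˡ _))

      -- If `W` begins with `e`, the two steps along `e` merge into one, with the same total. If `e`
      -- first occurs later, the part of `W` before it is a simple walk avoiding `e` from `v` to
      -- some `a` in `e`; `chord` forces `v` to be `a`, although `W` does not return to `v`.
      cons-simplified : ∀ {u v x} e (p : u ∈ˢ verts e) (q : v ∈ˢ verts e) (W : Walk v x) →
        Simple W → Simplified (cons e p q W)
      cons-simplified e p q nil s = cons-fresh e p q nil s _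
      cons-simplified {u} {v} e p q W@(cons {v = b} e′ p′ q′ W₁) s@(v∉ , e′∉ , s₁) with e Fin.≟ e′
      ... | yes refl = let W₂ , s₂ , eq = cons-fresh e p q′ W₁ s₁ e′∉ in
        W₂ , s₂ , trans eq (telescope (g e u) (g e v) (g e b) (total g W₁))
        where
        telescope : ∀ x y z t → (z ℤ.- x) ℤ.+ t ≡ (y ℤ.- x) ℤ.+ ((z ℤ.- y) ℤ.+ t)
        telescope = solve-∀
      ... | no e≢ with prefixBefore e W₁
      ...   | inj₁ e∉ = cons-fresh e p q W s (e≢ , e∉)
      ...   | inj₂ (a , a∈ , W′ , P , e∉) = contradiction
        (chord e (cons e′ p′ q′ W′) (Prefix-Simple {W = W} (cons P) s) (e≢ , e∉) q a∈)
        (Prefix-end P v∉)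

      simplify : ∀ {u x} (W : Walk u x) → Simplified W
      simplify nil = nil , _ , refl
      simplify (cons {u} {v} e p q W) with simplify W
      ... | W₁ , s₁ , eq₁ with cons-simplified e p q W₁ s₁
      ...   | W₂ , s₂ , eq₂ = W₂ , s₂ , trans eq₂ (cong (λ t → step g e u v ℤ.+ t) eq₁)

      -- Simplifying preserves the total, and a simple closed walk is empty because its first vertex
      -- may not recur.
      closed⇒total≡0 : ∀ {u} (W : Walk u u) → total g W ≡ 0ℤ
      closed⇒total≡0 W with simplify W
      ... | nil            , _        , eq = sym eq
      ... | cons e p q W′ , (u∉ , _) , _  =
        contradiction (sym (vertexAt-end W′)) (∉ᵛ⇒≢ W′ u∉ (fromℕ (len W′)))

  total-cong : ∀ {g g′ : Edge → Fin n → ℤ} → (∀ e v → g e v ≡ g′ e v) →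
    ∀ {u x} (W : Walk u x) → total g W ≡ total g′ W
  total-cong g≗ nil = refl
  total-cong g≗ (cons {u} {v} e _ _ W) =
    cong₂ ℤ._+_ (cong₂ ℤ._-_ (g≗ e v) (g≗ e u)) (total-cong g≗ W)

  module Height (tree : IsHypertree H) where

    walk : ∀ u v → Walk u v
    walk = connected⇒walk (proj₁ tree)

    height : (Edge → Fin n → ℤ) → Fin n → ℤ
    height g v = total g (walk (base v) v)

    height-cong : ∀ {g g′} → (∀ e v → g e v ≡ g′ e v) → height g ≗ height g′
    height-cong g≗ v = total-cong g≗ (walk (base v) v)

    -- The closed walks from the root to `v` and back, and from the root to `u`, across `e` to `v`
    -- and back, share their return. Both totals vanish, and the return cancels. Hence `height`
    -- agrees on every edge with the potential of that edge up to a constant.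
    height-step : ∀ g e {u v} → u ∈ˢ verts e → v ∈ˢ verts e → height g v ≡ height g u ℤ.+ step g e u v
    height-step g e {u} {v} u∈ v∈ rewrite base-const v u = solveFor
      (total g (walk r v)) (total g (walk r u)) (step g e u v) (total g (walk v r))
      (trans (sym (total-++ g (walk r v) (walk v r))) (closed⇒total≡0 g (walk r v ++ʷ walk v r)))
      (trans (sym (total-++ g (walk r u) (cons e u∈ v∈ (walk v r))))
        (closed⇒total≡0 g (walk r u ++ʷ cons e u∈ v∈ (walk v r))))
      where
      open Cycles (proj₂ tree)
      r = base u
      solveFor : ∀ a b s t → a ℤ.+ t ≡ 0ℤ → b ℤ.+ (s ℤ.+ t) ≡ 0ℤ → a ≡ b ℤ.+ s
      solveFor a b s t at bst = ∙-cancelʳ t a (b ℤ.+ s) (trans at (trans (sym bst) (sym (ℤ.+-assoc b s t))))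

-- The height of a proper colouring

-- The running sum along the chain of -1 for each strict cover and 1 for each weak one.
rise : ∀ {m} → Subset (m ∸ 1) → Fin m → ℤ
rise {suc m}       S             zero    = 0ℤ
rise {suc (suc m)} (inside  ∷ S) (suc p) = -1ℤ ℤ.+ rise S p
rise {suc (suc m)} (outside ∷ S) (suc p) = 1ℤ ℤ.+ rise S p

rise-inside : ∀ {m} (S : Subset (m ∸ 1)) i → i ∈ˢ S → rise {m} S (next i) ℤ.< rise {m} S (this i)
rise-inside {suc (suc m)} (inside  ∷ S) zero    here       = ℤ.-<+
rise-inside {suc (suc m)} (inside  ∷ S) (suc i) (there i∈) = ℤ.+-monoʳ-< -1ℤ (rise-inside {suc m} S i i∈)
rise-inside {suc (suc m)} (outside ∷ S) (suc i) (there i∈) = ℤ.+-monoʳ-< 1ℤ (rise-inside {suc m} S i i∈)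

rise-outside : ∀ {m} (S : Subset (m ∸ 1)) i → i ∉ˢ S → rise {m} S (this i) ℤ.< rise {m} S (next i)
rise-outside {suc (suc m)} (inside  ∷ S) zero    i∉ = contradiction here i∉
rise-outside {suc (suc m)} (outside ∷ S) zero    i∉ = ℤ.+<+ (s≤s z≤n)
rise-outside {suc (suc m)} (inside  ∷ S) (suc i) i∉ =
  ℤ.+-monoʳ-< -1ℤ (rise-outside {suc m} S i (i∉ ∘ there))
rise-outside {suc (suc m)} (outside ∷ S) (suc i) i∉ =
  ℤ.+-monoʳ-< 1ℤ (rise-outside {suc m} S i (i∉ ∘ there))

module Colouring {n : ℕ} (H : Hypergraph n) (tree : IsHypertree H)
  (decompose : ∀ e → e ∈ edges H → Decomposable e) where
  open Walks H
  open Height tree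

  module D (e : Edge) = Decomposable (decompose (verts e) (∈-lookup e))

  InClass : (Fin n → ℙ) → (e : Edge) → Bijection (verts e) → Set
  InClass χ e π = A π (D.S e π) (restrict (verts e) χ)

  choice : ∀ {χ} → Proper H χ → ∀ e → ∃ (InClass χ e)
  choice {χ} χ-proper e =
    Equivalence.to (D.union e (restrict (verts e) χ)) (All.lookup χ-proper (∈-lookup e))

  InClass⇒proper : ∀ {χ} → (∀ e → ∃ (InClass χ e)) → Proper H χ
  InClass⇒proper {χ} classes = All.tabulate λ {e} e∈ →
    subst (λ e → NonConstant (restrict e χ)) (sym (lookup-index e∈))
      (Equivalence.from (D.union (Any.index e∈) _) (classes (Any.index e∈)))

  potentialOf : ∀ e → Bijection (verts e) → Fin n → ℤ
  potentialOf e π v with v ∈? verts e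
  ... | yes v∈ = rise (D.S e π) (Inverse.to π (v , v∈))
  -- A default: the steps of a walk evaluate the potential of `e` only at members of `e`.
  ... | no _   = 0ℤ

  potentialOf-∈ : ∀ e π p → potentialOf e π (proj₁ (Inverse.from π p)) ≡ rise (D.S e π) p
  potentialOf-∈ e π p with Inverse.from π p in eq
  ... | v , v∈ with v ∈? verts e
  ...   | no v∉   = contradiction v∈ v∉
  ...   | yes v∈′ = cong (rise (D.S e π)) (Inverse.inverseˡ π
            (trans (cong (v ,_) ([]=-irrelevant v∈′ v∈)) (sym eq)))

  potentialOf-cong : ∀ e {π ρ} → π ≗ᵇ ρ → potentialOf e π ≗ potentialOf e ρ
  potentialOf-cong e π≗ρ v with v ∈? verts e
  ... | yes v∈ = cong₂ rise (D.S-cong e π≗ρ) (π≗ρ (v , v∈))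
  ... | no _   = refl

  -- The counting needs ranks and descents for every word, so improper colourings get the zero
  -- potential. The decision is an argument because the chosen chain may depend on the proof of
  -- properness that it carries.
  potential : ∀ {χ} → Dec (Proper H χ) → Edge → Fin n → ℤ
  potential (yes p) e = potentialOf e (proj₁ (choice p e))
  potential (no _)  e = λ _ → 0ℤ

  heightOf : ∀ {χ} → Dec (Proper H χ) → Fin n → ℤ
  heightOf χ? = height (potential χ?)

  -- Inside one edge, differences of height are differences of its potential, and these are
  -- differences of `rise`.
  height-compare : ∀ {χ} (χ? : Dec (Proper H χ)) e π → potential χ? e ≗ potentialOf e π → ∀ p q →
    rise (D.S e π) p ℤ.< rise (D.S e π) q →
    proj₁ (Inverse.from π p) ⊏[ heightOf χ? ] proj₁ (Inverse.from π q)
  height-compare χ? e π pot≗ p q p<q = major (begin-strict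
    h u                       ≡⟨ sym (ℤ.+-identityʳ (h u)) ⟩
    h u ℤ.+ 0ℤ                ≡⟨ cong (λ t → h u ℤ.+ t) (sym (ℤ.+-inverseʳ (g u))) ⟩
    h u ℤ.+ (g u ℤ.- g u)     <⟨ ℤ.+-monoʳ-< (h u) (ℤ.+-monoˡ-< (ℤ.- g u) (subst₂ ℤ._<_ (g≡ p) (g≡ q) p<q)) ⟩
    h u ℤ.+ (g v ℤ.- g u)     ≡⟨ sym (height-step (potential χ?) e u∈ v∈) ⟩
    h v                       ∎)
    where
    open ℤ.≤-Reasoning
    g = potential χ? e
    h = heightOf χ?
    u = proj₁ (Inverse.from π p)
    v = proj₁ (Inverse.from π q)
    u∈ = proj₂ (Inverse.from π p)
    v∈ = proj₂ (Inverse.from π q)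
    g≡ : ∀ p → rise (D.S e π) p ≡ potential χ? e (proj₁ (Inverse.from π p))
    g≡ p = trans (sym (potentialOf-∈ e π p)) (sym (pot≗ _))

  potential≗potentialOf : ∀ {χ} (χ? : Dec (Proper H χ)) → Proper H χ → ∀ e →
    ∃ λ π → InClass χ e π × potential χ? e ≗ potentialOf e π
  potential≗potentialOf (yes p) _ e = proj₁ (choice p e) , proj₂ (choice p e) , λ _ → refl
  potential≗potentialOf (no ¬p) p e = contradiction p ¬p

  -- The height makes each covering relation of the chain π, weak or strict,
  -- equivalent to one instance of the lexicographic order.
  InClass-refines : ∀ {χ χ′} (χ? : Dec (Proper H χ)) e π → potential χ? e ≗ potentialOf e π →
    (∀ {u v} → u ≺[ χ , heightOf χ? ] v → u ≺[ χ′ , heightOf χ? ] v) →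
    InClass χ e π → InClass χ′ e π
  InClass-refines {χ} {χ′} χ? e π pot≗ refines χ∈π i with i ∈? D.S e π
  ... | yes i∈ = ℕ.<⇒≤ strict , λ _ → strict
    where
    strict = ≺⇒strict (refines (major (proj₂ (χ∈π i) i∈)))
      (height-compare χ? e π pot≗ (next i) (this i) (rise-inside {∣ verts e ∣} (D.S e π) i i∈))
  ... | no i∉ = ≺⇒weak (refines (weak⇒≺ (proj₁ (χ∈π i))
      (height-compare χ? e π pot≗ (this i) (next i) (rise-outside {∣ verts e ∣} (D.S e π) i i∉))))
    , λ i∈ → contradiction i∈ i∉

  module Class {χ χ′ : Fin n → ℙ} (χ? : Dec (Proper H χ)) (χ′? : Dec (Proper H χ′)) (χ-proper : Proper H χ)
    {f : Fin n → ℙ} (asc : Ascending {n} (Standard.Des χ (heightOf χ?)) f)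
    (χ′≗ : χ′ ≗ f ∘ Standard.rank χ (heightOf χ?)) where

    private
      refines : ∀ {u v} → u ≺[ χ , heightOf χ? ] v → u ≺[ χ′ , heightOf χ? ] v
      refines u≺v = ≺-cong (λ v → sym (χ′≗ v)) (λ _ → refl)
        (Standard.ascending⇒refines χ (heightOf χ?) {f} asc u≺v)

    proper : Proper H χ′
    proper = InClass⇒proper λ e → let π , χ∈π , pot≗ = potential≗potentialOf χ? χ-proper e in
      π , InClass-refines χ? e π pot≗ refines χ∈π

    -- On each edge `χ′` still belongs to the class of the chain chosen for `χ`. Disjointness
    -- identifies this chain with the one chosen for `χ′`, so the potentials agree.
    heights-agree : heightOf χ? ≗ heightOf χ′?
    heights-agree = height-cong λ e v →
      let π , χ∈π , pot≗ = potential≗potentialOf χ? χ-proper e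
          ρ , χ′∈ρ , pot≗′ = potential≗potentialOf χ′? proper e
      in begin
        potential χ? e v   ≡⟨ pot≗ v ⟩
        potentialOf e π v  ≡⟨ potentialOf-cong e
          (D.disjoint e (restrict (verts e) χ′) (InClass-refines χ? e π pot≗ refines χ∈π) χ′∈ρ) v ⟩
        potentialOf e ρ v  ≡⟨ sym (pot≗′ v) ⟩
        potential χ′? e v  ∎
      where open ≡-Reasoning

    private
      refines′ : ∀ {u v} → u ≺[ χ , heightOf χ? ] v → u ≺[ χ′ , heightOf χ′? ] v
      refines′ u≺v = ≺-cong (λ _ → refl) heights-agree (refines u≺v)

    ranks-agree : Standard.rank χ (heightOf χ?) ≗ Standard.rank χ′ (heightOf χ′?)
    ranks-agree = rank-cong (≺-isStrictTotalOrder χ _) (≺-isStrictTotalOrder χ′ _) refines′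

    Des-agree : Standard.Des χ (heightOf χ?) ≡ Standard.Des χ′ (heightOf χ′?)
    Des-agree = Des-cong heights-agree refines′

-- Counting words by class

module _ {X Y : Set} where

  -- Followed by taking indices, `φ` becomes a map between finite index sets; it is injective
  -- because `ψ` recovers each entry of `xs`.
  retraction⇒length≤ : ∀ {xs : List X} {ys : List Y} → Unique xs → (φ : X → Y) (ψ : Y → X) →
    (∀ {x} → x ∈ xs → φ x ∈ ys) → (∀ {x} → x ∈ xs → ψ (φ x) ≡ x) → length xs ℕ.≤ length ys
  retraction⇒length≤ {xs} {ys} xs! φ ψ φ∈ ψφ = Fin.injective⇒≤ {f = index} λ {i} {j} eq →
    lookup-injective xs! (begin
      List.lookup xs i                ≡⟨ sym (recover i) ⟩
      ψ (List.lookup ys (index i))    ≡⟨ cong (ψ ∘ List.lookup ys) eq ⟩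
      ψ (List.lookup ys (index j))    ≡⟨ recover j ⟩
      List.lookup xs j                ∎)
    where
    open ≡-Reasoning
    index : Fin (length xs) → Fin (length ys)
    index i = Any.index (φ∈ (∈-lookup i))
    recover : ∀ i → ψ (List.lookup ys (index i)) ≡ List.lookup xs i
    recover i = trans (cong ψ (sym (lookup-index (φ∈ (∈-lookup i))))) (ψφ (∈-lookup i))

  length-cartesianProduct : ∀ (xs : List X) (ys : List Y) →
    length (cartesianProduct xs ys) ≡ length xs * length ys
  length-cartesianProduct []       ys = refl
  length-cartesianProduct (x ∷ xs) ys = trans (List.length-++ (map (x ,_) ys))
    (cong₂ _+_ (List.length-map (x ,_) ys) (length-cartesianProduct xs ys))

bijection⇒length≡ : ∀ {X Y : Set} {xs : List X} {ys : List Y} → Unique xs → Unique ys →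
  (φ : X → Y) (ψ : Y → X) →
  (∀ {x} → x ∈ xs → φ x ∈ ys) → (∀ {y} → y ∈ ys → ψ y ∈ xs) →
  (∀ {x} → x ∈ xs → ψ (φ x) ≡ x) → (∀ {y} → y ∈ ys → φ (ψ y) ≡ y) →
  length xs ≡ length ys
bijection⇒length≡ xs! ys! φ ψ φ∈ ψ∈ ψφ φψ = ℕ.≤-antisym
  (retraction⇒length≤ xs! φ ψ φ∈ ψφ) (retraction⇒length≤ ys! ψ φ ψ∈ φψ)

module _ {X Y : Set} {P : Pred X 0ℓ} (P? : Decidable P) (_≟_ : DecidableEquality Y) (g : X → Y) where

  fibre? : ∀ y x → Dec (P x × g x ≡ y)
  fibre? y x = P? x ×-dec (g x ≟ y)

  sum-zeros : ∀ (ys : List Y) → sum (map (λ _ → 0) ys) ≡ 0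
  sum-zeros []       = refl
  sum-zeros (_ ∷ ys) = sum-zeros ys

  fibres-skip : ∀ {x xs} ys → All (λ y → ¬ (P x × g x ≡ y)) ys →
    sum (map (λ y → length (filter (fibre? y) (x ∷ xs))) ys) ≡
    sum (map (λ y → length (filter (fibre? y) xs)) ys)
  fibres-skip []       []             = refl
  fibres-skip (y ∷ ys) (¬fibre ∷ ¬fs) = cong₂ _+_
    (cong length (List.filter-reject (fibre? y) ¬fibre)) (fibres-skip ys ¬fs)

  fibres-hit : ∀ {x xs ys} → Unique ys → P x → g x ∈ ys →
    sum (map (λ y → length (filter (fibre? y) (x ∷ xs))) ys) ≡
    suc (sum (map (λ y → length (filter (fibre? y) xs)) ys))
  fibres-hit {ys = y ∷ ys} (y∉ ∷ _) px (here eq) = cong₂ _+_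
    (cong length (List.filter-accept (fibre? y) (px , eq)))
    (fibres-skip ys (All.map (λ y≢ (_ , gx≡) → y≢ (trans (sym eq) gx≡)) y∉))
  fibres-hit {xs = xs} {y ∷ ys} (y∉ ∷ ys!) px (there gx∈) = trans (cong₂ _+_
    (cong length (List.filter-reject (fibre? y) {xs = xs} (λ (_ , gx≡y) → All.lookup y∉ gx∈ (sym gx≡y))))
    (fibres-hit ys! px gx∈)) (ℕ.+-suc (length (filter (fibre? y) xs)) _)

  -- A new head satisfying `P` enlarges exactly one fibre, since its value under `g` occurs once in
  -- `ys`; any other head enlarges none.
  length-filter-fibres : ∀ {ys} → Unique ys → (∀ x → g x ∈ ys) → ∀ xs →
    length (filter P? xs) ≡ sum (map (λ y → length (filter (fibre? y) xs)) ys)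
  length-filter-fibres {ys} ys! g∈ [] = sym (sum-zeros ys)
  length-filter-fibres {ys} ys! g∈ (x ∷ xs) = helper (P? x)
    where
    helper : Dec (P x) → length (filter P? (x ∷ xs)) ≡ sum (map (λ y → length (filter (fibre? y) (x ∷ xs))) ys)
    helper (yes px) = trans (cong length (List.filter-accept P? px))
      (trans (cong suc (length-filter-fibres ys! g∈ xs)) (sym (fibres-hit ys! px (g∈ x))))
    helper (no ¬px) = trans (cong length (List.filter-reject P? ¬px))
      (trans (length-filter-fibres ys! g∈ xs) (sym (fibres-skip ys (All.universal (λ _ → ¬px ∘ proj₁) ys))))

module _ {X : Set} where

  vectors-unique : ∀ {xs : List X} → Unique xs → ∀ n → Unique (vectors xs n)
  vectors-unique xs! zero    = [] ∷ []
  vectors-unique xs! (suc n) = Unique.cartesianProductWith⁺ _∷_ ∷-injective xs! (vectors-unique xs! n)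

  ∈-vectors⁺ : ∀ {xs : List X} {n} (w : Vec X n) → (∀ i → lookup w i ∈ xs) → w ∈ vectors xs n
  ∈-vectors⁺ []      _  = here refl
  ∈-vectors⁺ (x ∷ w) w∈ = ∈-cartesianProductWith⁺ _∷_ (w∈ zero) (∈-vectors⁺ w (w∈ ∘ suc))

  ∈-vectors⁻ : ∀ {xs : List X} {n} {w : Vec X n} → w ∈ vectors xs n → ∀ i → lookup w i ∈ xs
  ∈-vectors⁻ {xs} {suc n} w∈ i with ∈-cartesianProductWith⁻ _∷_ xs (vectors xs n) w∈
  ∈-vectors⁻ {xs} {suc n} w∈ zero    | _ , _ , x∈ , _ , refl   = x∈
  ∈-vectors⁻ {xs} {suc n} w∈ (suc i) | _ , _ , _ , w′∈ , refl = ∈-vectors⁻ w′∈ i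

-- Rearrangements of words

-- As a sum of indicators, the count inherits the invariance of finite sums under permutations.
count≡∑ : ∀ {X : Set} {P : Pred X 0ℓ} (P? : Decidable P) {n} (w : Vec X n) →
  count P? w ≡ ∑ (λ i → if does (P? (lookup w i)) then 1 else 0)
count≡∑ P? []      = refl
count≡∑ P? (x ∷ w) with does (P? x)
... | true  = cong suc (count≡∑ P? w)
... | false = count≡∑ P? w

rearranged : ∀ {X : Set} {n} → (Fin n → Fin n) → Vec X n → Vec X n
rearranged σ w = tabulate (lookup w ∘ σ)

module _ {n : ℕ} {σ τ : Fin n → Fin n} (στ : ∀ i → σ (τ i) ≡ i) (τσ : ∀ i → τ (σ i) ≡ i) where

  count-rearranged : ∀ {X : Set} {P : Pred X 0ℓ} (P? : Decidable P) (w : Vec X n) →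
    count P? (rearranged σ w) ≡ count P? w
  count-rearranged P? w = begin
    count P? (rearranged σ w)               ≡⟨ count≡∑ P? (rearranged σ w) ⟩
    ∑ (weight ∘ lookup (rearranged σ w))    ≡⟨ sum-cong-≗ (λ i → cong weight (lookup∘tabulate (lookup w ∘ σ) i)) ⟩
    ∑ (weight ∘ lookup w ∘ σ)               ≡⟨ sym (sum-permute (weight ∘ lookup w) (permutation σ τ στ τσ)) ⟩
    ∑ (weight ∘ lookup w)                   ≡⟨ sym (count≡∑ P? w) ⟩
    count P? w                              ∎
    where
    open ≡-Reasoning
    weight = λ x → if does (P? x) then 1 else 0

  exponents-rearranged : ∀ k (w : Vec ℙ n) → exponents k (rearranged σ w) ≡ exponents k w
  exponents-rearranged k w = List.map-cong (λ i → count-rearranged (i ℕ.≟_) w) (upTo k)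

∈-vectors-rearranged : ∀ {X : Set} {xs : List X} {n} (σ : Fin n → Fin n) {w : Vec X n} →
  w ∈ vectors xs n → rearranged σ w ∈ vectors xs n
∈-vectors-rearranged {xs = xs} σ {w} w∈ = ∈-vectors⁺ _ λ i →
  subst (_∈ xs) (sym (lookup∘tabulate (lookup w ∘ σ) i)) (∈-vectors⁻ w∈ (σ i))

∈-sides : ∀ s → s ∈ inside ∷ outside ∷ []
∈-sides true  = here refl
∈-sides false = there (here refl)

sides-unique : Unique (inside ∷ outside ∷ [])
sides-unique = ((λ ()) ∷ []) ∷ [] ∷ []

foldr-+-pos : ∀ {X : Set} (a b : X → ℕ) xs →
  foldr ℤ._+_ 0ℤ (map (λ x → + a x ℤ.* + b x) xs) ≡ + sum (map (λ x → a x * b x) xs)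
foldr-+-pos a b []       = refl
foldr-+-pos a b (x ∷ xs) = trans
  (cong₂ ℤ._+_ (sym (ℤ.pos-* (a x) (b x))) (foldr-+-pos a b xs))
  (sym (ℤ.pos-+ (a x * b x) _))

-- The positions increase strictly, which meets the conditions of every `S`; this is why each class
-- contains its word of ranks.
toℕ-ascending : ∀ {m} (S : Subset (m ∸ 1)) → Ascending {m} S toℕ
toℕ-ascending {m} S i = ℕ.<⇒≤ (this<next {m} i) , λ _ → this<next {m} i

rearranged-inverse : ∀ {X : Set} {n} {σ τ : Fin n → Fin n} → (∀ i → τ (σ i) ≡ i) → (w : Vec X n) →
  rearranged σ (rearranged τ w) ≡ w
rearranged-inverse {σ = σ} {τ} τσ w = trans
  (tabulate-cong λ i → trans (lookup∘tabulate (lookup w ∘ τ) (σ i)) (cong (lookup w) (τσ i)))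
  (tabulate∘lookup w)

-- A word is recovered from its class, represented by the word of its ranks, and
-- its weakly increasing rearrangement.
module Expansion {n : ℕ} {P : Pred (Vec ℙ n) 0ℓ} (P? : Decidable P)
  (rank unrank : Vec ℙ n → Fin n → Fin n) (Des : Vec ℙ n → Subset (n ∸ 1))
  (rank-unrank : ∀ w i → rank w (unrank w i) ≡ i)
  (unrank-rank : ∀ w v → unrank w (rank w v) ≡ v)
  (ascending : ∀ w → Ascending {n} (Des w) (lookup w ∘ unrank w))
  (class : ∀ {w w′} → P w → (f : Fin n → ℙ) → Ascending {n} (Des w) f → lookup w′ ≗ f ∘ rank w →
           P w′ × rank w ≗ rank w′ × Des w ≡ Des w′) where

  std : Vec ℙ n → Vec ℙ n
  std w = tabulate (toℕ ∘ rank w)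

  std-class : ∀ {w} → P w → P (std w) × rank w ≗ rank (std w) × Des w ≡ Des (std w)
  std-class {w} w∈P = class w∈P toℕ (toℕ-ascending (Des w)) (lookup∘tabulate (toℕ ∘ rank w))

  merge : Vec ℙ n × Vec ℙ n → Vec ℙ n
  merge (m , f) = rearranged (rank m) f

  split : Vec ℙ n → Vec ℙ n × Vec ℙ n
  split w = std w , rearranged (unrank w) w

  merge-class : ∀ {m} f → P m → Ascending {n} (Des m) (lookup f) →
    P (merge (m , f)) × rank m ≗ rank (merge (m , f)) × Des m ≡ Des (merge (m , f))
  merge-class {m} f m∈P asc = class m∈P (lookup f) asc (lookup∘tabulate (lookup f ∘ rank m))

  std-cong : ∀ {w w′} → rank w ≗ rank w′ → std w ≡ std w′
  std-cong rank≗ = tabulate-cong (cong toℕ ∘ rank≗)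

  std∈words : ∀ w → std w ∈ vectors (upTo n) n
  std∈words w = ∈-vectors⁺ (std w) λ i →
    subst (_∈ upTo n) (sym (lookup∘tabulate (toℕ ∘ rank w) i)) (∈-upTo⁺ (Fin.toℕ<n (rank w i)))

  _≟ˢ_ : (S T : Subset (n ∸ 1)) → Dec (S ≡ T)
  _≟ˢ_ = ≡-dec Bool._≟_

  -- Words with the same ranks have the same `std`, so the fixed points of `std` pick one word from
  -- each class.
  IsRepresentative : Subset (n ∸ 1) → Vec ℙ n → Set
  IsRepresentative S w = (P w × std w ≡ w) × Des w ≡ S

  isRepresentative? : ∀ S w → Dec (IsRepresentative S w)
  isRepresentative? S w = (P? w ×-dec ≡-dec ℕ._≟_ (std w) w) ×-dec (Des w ≟ˢ S)

  -- Ranks are below `n`, so letters below `n` suffice. The list does not involve `α`, as a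
  -- coefficient in the expansion must not.
  representatives : Subset (n ∸ 1) → List (Vec ℙ n)
  representatives S = filter (isRepresentative? S) (vectors (upTo n) n)

  module _ (α : List ℕ) where
    private
      k     = length α
      words = vectors (upTo k) n

      words! : Unique words
      words! = vectors-unique (Unique.upTo⁺ k) n

    memberWord? : ∀ w → Dec (P w × exponents k w ≡ α)
    memberWord? w = P? w ×-dec List.≡-dec ℕ._≟_ (exponents k w) α

    ascendingWord? : ∀ S w → Dec (Ascending {n} S (lookup w) × exponents k w ≡ α)
    ascendingWord? S w = ascending? {n} S (lookup w) ×-dec List.≡-dec ℕ._≟_ (exponents k w) α

    memberWords ascendingWords : Subset (n ∸ 1) → List (Vec ℙ n)
    memberWords S = filter (fibre? memberWord? _≟ˢ_ Des S) words
    ascendingWords S = filter (ascendingWord? S) words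

    module _ (S : Subset (n ∸ 1)) where

      split∈ : ∀ {w} → w ∈ memberWords S → split w ∈ cartesianProduct (representatives S) (ascendingWords S)
      split∈ {w} w∈ with ∈-filter⁻ (fibre? memberWord? _≟ˢ_ Des S) {xs = words} w∈
      ... | w∈words , (w∈P , exp) , refl = let std∈P , ranks , Des≡ = std-class w∈P in
        ∈-cartesianProduct⁺
          (∈-filter⁺ (isRepresentative? S) (std∈words w) ((std∈P , sym (std-cong ranks)) , sym Des≡))
          (∈-filter⁺ (ascendingWord? S) (∈-vectors-rearranged (unrank w) w∈words)
            ( (λ i → subst₂ ℕ._≤_ (at (this i)) (at (next i)) (proj₁ (ascending w i))
                   , subst₂ ℕ._<_ (at (this i)) (at (next i)) ∘ proj₂ (ascending w i))
            , trans (exponents-rearranged (unrank-rank w) (rank-unrank w) k w) exp))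
        where
        at : ∀ i → lookup w (unrank w i) ≡ lookup (rearranged (unrank w) w) i
        at i = sym (lookup∘tabulate (lookup w ∘ unrank w) i)

      pair⁻ : ∀ {m f} → (m , f) ∈ cartesianProduct (representatives S) (ascendingWords S) →
        IsRepresentative S m × f ∈ words × Ascending {n} S (lookup f) × exponents k f ≡ α
      pair⁻ mf∈ = let m∈ , f∈ = ∈-cartesianProduct⁻ (representatives S) (ascendingWords S) mf∈ in
        proj₂ (∈-filter⁻ (isRepresentative? S) {xs = vectors (upTo n) n} m∈) ,
        ∈-filter⁻ (ascendingWord? S) {xs = words} f∈

      merge∈ : ∀ {mf} → mf ∈ cartesianProduct (representatives S) (ascendingWords S) → merge mf ∈ memberWords S
      merge∈ {m , f} mf∈ with pair⁻ mf∈
      ... | ((m∈P , _) , refl) , f∈words , asc , exp = let mf∈P , _ , Des≡ = merge-class f m∈P asc in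
        ∈-filter⁺ (fibre? memberWord? _≟ˢ_ Des S) (∈-vectors-rearranged (rank m) f∈words)
          ((mf∈P , trans (exponents-rearranged (rank-unrank m) (unrank-rank m) k f) exp) , sym Des≡)

      -- The word is sorted by its own vertex ordering and spread out again by that of `std w`; the
      -- two orderings agree.
      merge-split : ∀ {w} → w ∈ memberWords S → merge (split w) ≡ w
      merge-split {w} w∈ with ∈-filter⁻ (fibre? memberWord? _≟ˢ_ Des S) {xs = words} w∈
      ... | _ , (w∈P , _) , _ = let _ , ranks , _ = std-class w∈P in rearranged-inverse
        (λ v → trans (cong (unrank w) (sym (ranks v))) (unrank-rank w v)) w

      -- The merged word has the ranks of `m`. So its `std` is that of `m`, which is `m` itself, and
      -- sorting it gives back `f`.
      split-merge : ∀ {mf} → mf ∈ cartesianProduct (representatives S) (ascendingWords S) → split (merge mf) ≡ mf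
      split-merge {m , f} mf∈ with pair⁻ mf∈
      ... | ((m∈P , std-m) , refl) , _ , asc , _ = let _ , ranks , _ = merge-class f m∈P asc in cong₂ _,_
        (trans (sym (std-cong ranks)) std-m)
        (rearranged-inverse (λ i → trans (ranks (unrank w i)) (rank-unrank w i)) f)
        where w = merge (m , f)

      length-memberWords : length (memberWords S) ≡ length (representatives S) * length (ascendingWords S)
      length-memberWords = trans
        (bijection⇒length≡ (Unique.filter⁺ _ words!)
          (Unique.cartesianProduct⁺ (Unique.filter⁺ _ (vectors-unique (Unique.upTo⁺ n) n)) (Unique.filter⁺ _ words!))
          split merge split∈ merge∈ merge-split split-merge)
        (length-cartesianProduct (representatives S) (ascendingWords S))

    -- The words with exponents `α` are sorted by `Des`. The fibre over `S` is a product of the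
    -- representatives with the ascending words, and the latter are what the coefficient of `F S` at
    -- `α` counts.
    ∑x-expansion : ∑x P? α ≡ F-combination n (λ S → + length (representatives S)) α
    ∑x-expansion = begin
      + length (filter memberWord? words)
        ≡⟨ cong +_ (length-filter-fibres memberWord? _≟ˢ_ Des (vectors-unique sides-unique (n ∸ 1))
             (λ w → ∈-vectors⁺ (Des w) (λ i → ∈-sides (lookup (Des w) i))) words) ⟩
      + sum (map (length ∘ memberWords) subsets)
        ≡⟨ cong (+_ ∘ sum) (List.map-cong length-memberWords subsets) ⟩
      + sum (map (λ S → length (representatives S) * length (ascendingWords S)) subsets)
        ≡⟨ sym (foldr-+-pos (length ∘ representatives) (length ∘ ascendingWords) subsets) ⟩
      F-combination n (λ S → + length (representatives S)) α ∎
      where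
      open ≡-Reasoning
      subsets = vectors (inside ∷ outside ∷ []) (n ∸ 1)

  F-positive : F-Positive n (∑x P?)
  F-positive = (λ S → + length (representatives S)) , ∑x-expansion , λ _ → ℤ.+≤+ z≤n

theorem5p1 : ∀ (n : ℕ) (H : Hypergraph n) → IsHypertree H → (∀ e → e ∈ edges H → Decomposable e) → F-Positive n (X H)
theorem5p1 n H tree decompose = Expansion.F-positive proper?ʷ S.rank S.unrank S.Des
  S.rank-unrank S.unrank-rank S.ascending
  λ {w} {w′} w-proper f asc w′≗ →
    let module C = Class (proper?ʷ w) (proper?ʷ w′) w-proper {f} asc w′≗
    in C.proper , C.ranks-agree , C.Des-agree
  where
  open Colouring H tree decompose
  proper?ʷ : ∀ w → Dec (Proper H (lookup w))
  proper?ʷ w = proper? H (lookup w)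
  -- The height varies with the word, through the chains that the word selects on the edges.
  module S (w : Vec ℙ n) = Standard (lookup w) (heightOf (proper?ʷ w))
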